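{- For all $n\ge 1$, $\mathsf{ORT}_{\mathbb N}[n] \le_{\mathrm{sW}} (\mathsf{ECT})^n\times \mathsf{WOP}(X\mapsto X^n_{lex})$.
   Context: A problem is a partial multi-valued function from instances to sets of solutions. $\mathsf P\le_{\mathrm{sW}}\mathsf Q$ means there are Turing functionals $H,K$ such that for every $\mathsf P$-instance $X$, $H(X)$ is a $\mathsf Q$-instance, and for every $\mathsf Q$-solution $\hat Y$ to $H(X)$, $K(\hat Y)$ is a $\mathsf P$-solution to $X$. The parallel product $\mathsf P\times\mathsf Q$ has instances pairs $(X_0,X_1)$ of a $\mathsf P$-instance and a $\mathsf Q$-instance, with solutions pairs of respective solutions; $\mathsf P^n$ is the $n$-fold parallel product of $\mathsf P$ with itself. $\mathsf{ORT}_{\mathbb N}$: a colouring $c:[\mathbb N]^2\to P$ into a poset $(P,\le_P)$ is right-ordered if $c(x,y)\le_P c(x,y')$ whenever $x<y\le y'$; instances are finite posets with a right-ordered colouring, solutions are infinite $c$-homogeneous subsets of $\mathbb N$. $\mathsf{ORT}_{\mathbb N}[n]$ is the restriction of $\mathsf{ORT}_{\mathbb N}$ to instances $(P,c)$ with $|P|=n$. $\mathsf{ECT}$: instances are pairs $(k,f)$ with $f:\mathbb N\to\{0,\dots,k-1\}$; $b$ is a solution iff for every $x>b$ there is $y>x$ with $f(x)=f(y)$. $\mathsf{WOP}(X\mapsto X^n_{lex})$: an instance is a linear order $X$ together with an infinite sequence $\sigma=(\sigma_i)_{i\ge0}$ in $X^n$ that is strictly decreasing in the lexicographic order $<_{lex}$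 on $X^n$; a solution is an infinite strictly decreasing sequence in $X$ whose terms occur as components of terms of $\sigma$, in the same relative order (the $i$-th term is a component of $\sigma_{t_i}$ with $t_i\le t_j$ for $i<j$). -}

module Defs where

open import Data.Nat using (ℕ; zero; suc; _+_; _*_; _≤_; _<_)
open import Data.Maybe using (Maybe; just; nothing)
open import Data.Product using (Σ; ∃; _×_; _,_)
open import Data.Unit using (⊤)
open import Data.Sum using (_⊎_)
open import Relation.Binary.PropositionalEquality using (_≡_; _≢_)

Baire : Set
Baire = ℕ → ℕ

tri : ℕ → ℕ
tri zero    = 0
tri (suc n) = suc n + tri n

pair : ℕ → ℕ → ℕ
pair x y = tri (x + y) + y

-- Interleaving: a Baire element Z codes the pair (π₀ Z , π₁ Z)
π₀ : Baire → Baire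
π₀ Z n = Z (2 * n)

π₁ : Baire → Baire
π₁ Z n = Z (suc (2 * n))

_∈ₛ_ : ℕ → Baire → Set
x ∈ₛ S = 0 < S x

-- Problems (partial multi-valued functions on Baire space)

record Problem : Set₁ where
  field
    Inst : Baire → Set
    Sol  : Baire → Baire → Set
open Problem public

-- Turing functionals, modelled as (Agda-computable) step functions:
-- F X x s = result of running the functional with oracle X on input x
-- for s steps (nothing = not yet halted).

Functional : Set
Functional = Baire → ℕ → ℕ → Maybe ℕ

Computes : Functional → Baire → Baire → Set
Computes F X Y = ∀ x → ∃ λ s → (F X x s ≡ just (Y x))
                                × (∀ t → t < s → F X x t ≡ nothing)

_≤sW_ : Problem → Problem → Set
P ≤sW Q = Σ Functional λ H → Σ Functional λ K →
  ∀ X → Inst P X →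
    Σ Baire λ Y → Computes H X Y × Inst Q Y ×
      (∀ Ŷ → Sol Q Y Ŷ → Σ Baire λ Z → Computes K Ŷ Z × Sol P X Z)

_×ₚ_ : Problem → Problem → Problem
Inst (P ×ₚ Q) Z   = Inst P (π₀ Z) × Inst Q (π₁ Z)
Sol  (P ×ₚ Q) Z W = Sol P (π₀ Z) (π₀ W) × Sol Q (π₁ Z) (π₁ W)

-- trivial problem (only used for the unused case n = 0 of _^ₚ_)
unitP : Problem
Inst unitP _   = ⊤
Sol  unitP _ _ = ⊤

_^ₚ_ : Problem → ℕ → Problem
P ^ₚ zero          = unitP
P ^ₚ suc zero      = P
P ^ₚ suc (suc n)   = P ×ₚ (P ^ₚ suc n)

-- ORT_ℕ
-- Instance code Z: the poset has carrier {0,…,k-1} with k = π₀ Z 0,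
-- i ≤_P j  iff  π₀ (π₁ Z) (pair i j) ≡ 0, and the colouring is
-- c(x,y) = π₁ (π₁ Z) (pair x y) for x < y.

ortSize : Baire → ℕ
ortSize Z = π₀ Z 0

ortLeq : Baire → ℕ → ℕ → Set
ortLeq Z i j = π₀ (π₁ Z) (pair i j) ≡ 0

ortCol : Baire → ℕ → ℕ → ℕ
ortCol Z x y = π₁ (π₁ Z) (pair x y)

IsFinPoset : ℕ → (ℕ → ℕ → Set) → Set
IsFinPoset k le =
    (∀ i → i < k → le i i)
  × (∀ i j → i < k → j < k → le i j → le j i → i ≡ j)
  × (∀ i j l → i < k → j < k → l < k → le i j → le j l → le i l)

ORTInst : Baire → Set
ORTInst Z =
    IsFinPoset (ortSize Z) (ortLeq Z)
  × (∀ x y → x < y → ortCol Z x y < ortSize Z)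
  × (∀ x y y′ → x < y → y ≤ y′ → ortLeq Z (ortCol Z x y) (ortCol Z x y′))

InfiniteSet : Baire → Set
InfiniteSet S = ∀ m → ∃ λ x → m ≤ x × x ∈ₛ S

ORTSol : Baire → Baire → Set
ORTSol Z S =
    InfiniteSet S
  × (∃ λ p → ∀ x y → x < y → x ∈ₛ S → y ∈ₛ S → ortCol Z x y ≡ p)

ORT : Problem
Inst ORT = ORTInst
Sol  ORT = ORTSol

ORT[_] : ℕ → Problem
Inst ORT[ n ] Z = ORTInst Z × ortSize Z ≡ n
Sol  ORT[ n ]   = ORTSol

-- ECT: instance code Z: k = π₀ Z 0, f = π₁ Z; a solution W codes b = W 0.

ECT : Problem
Inst ECT Z   = ∀ x → π₁ Z x < π₀ Z 0
Sol  ECT Z W = ∀ x → W 0 < x → ∃ λ y → x < y × π₁ Z x ≡ π₁ Z y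

-- WOP(X ↦ X^n_lex)
-- Instance code Z: domain of X = {x | x ∈ₛ π₀ Z},
-- x ≤_X y iff π₀ (π₁ Z) (pair x y) ≡ 0,
-- j-th component (j < n) of σ_i is π₁ (π₁ Z) (pair i j).

wDom : Baire → ℕ → Set
wDom Z x = x ∈ₛ π₀ Z

wLe : Baire → ℕ → ℕ → Set
wLe Z x y = π₀ (π₁ Z) (pair x y) ≡ 0

wLt : Baire → ℕ → ℕ → Set
wLt Z x y = wLe Z x y × x ≢ y

wσ : Baire → ℕ → ℕ → ℕ
wσ Z i j = π₁ (π₁ Z) (pair i j)

IsLinearOrder : (ℕ → Set) → (ℕ → ℕ → Set) → Set
IsLinearOrder D le =
    (∀ x → D x → le x x)
  × (∀ x y → D x → D y → le x y → le y x → x ≡ y)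
  × (∀ x y z → D x → D y → D z → le x y → le y z → le x z)
  × (∀ x y → D x → D y → (le x y ⊎ le y x))

LexLt : (ℕ → ℕ → Set) → ℕ → (ℕ → ℕ) → (ℕ → ℕ) → Set
LexLt lt n τ υ = ∃ λ j → j < n × (∀ l → l < j → τ l ≡ υ l) × lt (τ j) (υ j)

WOPlex : ℕ → Problem
Inst (WOPlex n) Z =
    IsLinearOrder (wDom Z) (wLe Z)
  × (∀ i j → j < n → wDom Z (wσ Z i j))
  × (∀ i → LexLt (wLt Z) n (wσ Z (suc i)) (wσ Z i))
Sol (WOPlex n) Z W =
    (∀ i → wDom Z (W i))
  × (∀ i → wLt Z (W (suc i)) (W i))
  × (∃ λ (t : ℕ → ℕ) → (∀ i j → i < j → t i ≤ t j)
                      × (∀ i → ∃ λ j → j < n × W i ≡ wσ Z (t i) j))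

-- Rank the n colours by a depth that reverses the poset order. At each stage
-- s the event is the least depth of a colour c(x, s + 1) that is new, i.e.
-- taken by x = s or by an x < s whose colour changes at s; the events form
-- the ECT instance. Register j records, at time T, when it was last renewed
-- by an event below j (its version) and last restarted by an event at most
-- j (its start), together with the trigger of that restart; read as codes
-- in a suitable order, the registers descend lexicographically from stage to
-- stage.
--
-- Let b bound the non-recurring events and follow a descending sequence of
-- registers. It cannot stay in a register above a recurring event forever,
-- since each recurrence renews that register's version and bounds its
-- restarts, so it settles in a register j₀ with every event after b at least
-- j₀. From then on it reads restarts at events of value exactly j₀, whose
-- triggers take colours of depth j₀ that can never change again: by
-- right-orderedness a change would lower the depth and cause an event below
-- j₀. These triggers are pairwise distinct and all have the same colour, so
-- choosing them far enough apart gives an infinite homogeneous set.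

module Submission where

open import Defs
open import Data.Bool using (if_then_else_; T; T?)
open import Data.Empty using (⊥)
open import Data.Unit using (⊤)
open import Data.Fin using (Fin; toℕ; fromℕ<)
import Data.Fin.Properties as Fin
open import Data.Maybe using (Maybe; just; nothing; is-just; maybe′; _>>=_)
open import Data.Maybe.Properties using (map-just)
open import Data.Nat
open import Data.Nat.Induction using (<-wellFounded)
open import Data.Nat.Properties
open import Data.Product using (Σ; ∃; ∃₂; _×_; _,_; proj₁; proj₂; uncurry)
open import Data.Product.Relation.Binary.Pointwise.NonDependent using (Pointwise)
open import Data.Product.Relation.Binary.Lex.Strict
  using (×-Lex; ×-isStrictTotalOrder; ×-wellFounded)
open import Data.Sum using (_⊎_; inj₁; inj₂; [_,_]′)
open import Function using (_∘_; _on_; _⇔_; Equivalence; mk⇔)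
open import Induction.WellFounded using (Acc; acc)
open import Level using (0ℓ)
open import Relation.Binary using (Rel; Decidable; IsStrictTotalOrder; tri<; tri≈; tri>; _⇒_)
import Relation.Binary.Construct.Flip.EqAndOrd as Flip
import Relation.Binary.Construct.On as On
open import Relation.Binary.PropositionalEquality
open import Relation.Nullary using (¬_; ¬?; Dec; yes; no; does; contradiction)
open import Relation.Nullary.Decidable using (_×-dec_)
import Relation.Unary as U

private
  nextPair : ℕ × ℕ → ℕ × ℕ
  nextPair (zero  , y) = suc y , 0
  nextPair (suc x , y) = x , suc y

  pair-nextPair : ∀ p → uncurry pair (nextPair p) ≡ suc (uncurry pair p)
  pair-nextPair (zero  , y) rewrite +-identityʳ y | +-identityʳ (suc y + tri y) =
    cong suc (+-comm y (tri y))
  pair-nextPair (suc x , y) rewrite +-suc x y | +-suc (tri (suc (x + y))) y = refl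

  pair≡0 : ∀ x y → pair x y ≡ 0 → (x , y) ≡ (0 , 0)
  pair≡0 zero    zero    _ = refl
  pair≡0 (suc x) zero    ()
  pair≡0 x       (suc y) e = contradiction (trans (sym (+-suc (tri (x + suc y)) y)) e) λ ()

unpair : ℕ → ℕ × ℕ
unpair zero    = 0 , 0
unpair (suc m) = nextPair (unpair m)

pair-unpair : ∀ m → uncurry pair (unpair m) ≡ m
pair-unpair zero    = refl
pair-unpair (suc m) = trans (pair-nextPair (unpair m)) (cong suc (pair-unpair m))

unpair-pair : ∀ x y → unpair (pair x y) ≡ (x , y)
unpair-pair x y = go (pair x y) x y refl
  where
  go : ∀ m x y → pair x y ≡ m → unpair m ≡ (x , y)
  go zero    x       y       e = sym (pair≡0 x y e)
  go (suc m) zero    zero    ()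
  go (suc m) x       (suc y) e =
    cong nextPair (go m (suc x) y (suc-injective (trans (sym (pair-nextPair (suc x , y))) e)))
  go (suc m) (suc x) zero    e =
    cong nextPair (go m zero x (suc-injective (trans (sym (pair-nextPair (zero , x))) e)))

interleave : Baire → Baire → Baire
interleave A B zero          = A 0
interleave A B (suc zero)    = B 0
interleave A B (suc (suc m)) = interleave (A ∘ suc) (B ∘ suc) m

π₀-interleave : ∀ A B → π₀ (interleave A B) ≗ A
π₀-interleave A B zero    = refl
π₀-interleave A B (suc k) rewrite +-suc k (k + 0) = π₀-interleave (A ∘ suc) (B ∘ suc) k

π₁-interleave : ∀ A B → π₁ (interleave A B) ≗ B
π₁-interleave A B zero    = refl
π₁-interleave A B (suc k) rewrite +-suc k (k + 0) = π₁-interleave (A ∘ suc) (B ∘ suc) k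

Least : (ℕ → Set) → ℕ → Set
Least P i = P i × (∀ k → k < i → ¬ P k)

Least-unique : ∀ {P i j} → Least P i → Least P j → i ≡ j
Least-unique {i = i} {j} (Pi , below-i) (Pj , below-j) with <-cmp i j
... | tri< i<j _ _ = contradiction Pi (below-j i i<j)
... | tri≈ _ i≡j _ = i≡j
... | tri> _ _ j<i = contradiction Pj (below-i j j<i)

module _ {P : ℕ → Set} (P? : U.Decidable P) where

  search : ℕ → Maybe ℕ
  search zero = nothing
  search (suc s) with search s
  ... | just i  = just i
  ... | nothing = if does (P? s) then just s else nothing

  search-nothing : ∀ s → search s ≡ nothing → ∀ k → k < s → ¬ P k
  search-just : ∀ s {i} → search s ≡ just i → Least P i × i < s

  search-nothing (suc s) e k k<1+s with search s in e′
  search-nothing (suc s) () k k<1+s | just _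
  ... | nothing with P? s | m≤n⇒m<n∨m≡n (≤-pred k<1+s)
  search-nothing (suc s) () k k<1+s | nothing | yes _ | _
  ... | no _   | inj₁ k<s = search-nothing s e′ k k<s
  ... | no ¬Ps | inj₂ refl = ¬Ps

  search-just (suc s) e with search s in e′
  search-just (suc s) refl | just i = let least-i , i<s = search-just s e′ in least-i , m<n⇒m<1+n i<s
  ... | nothing with P? s
  search-just (suc s) refl | nothing | yes Ps = (Ps , search-nothing s e′) , ≤-refl

  search-finds : ∀ s {i} → Least P i → i < s → search s ≡ just i
  search-finds s {i} least i<s with search s in e
  ... | just j = cong just (Least-unique (proj₁ (search-just s e)) least)
  ... | nothing = contradiction (proj₁ least) (search-nothing s e i i<s)

  search-none : ∀ s → (∀ k → k < s → ¬ P k) → search s ≡ nothing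
  search-none s none with search s in e
  ... | just j  = let ((Pj , _) , j<s) = search-just s e in contradiction Pj (none j j<s)
  ... | nothing = refl

  least : ∀ {i} → P i → ∃ (Least P)
  least {i} Pi with search (suc i) in e
  ... | just j  = j , proj₁ (search-just (suc i) e)
  ... | nothing = contradiction Pi (search-nothing (suc i) e i ≤-refl)

-- Computes demands silence before the answer, so only the first answer of
-- a step function is passed on.

Answered : Maybe ℕ → Set
Answered m = T (is-just m)

answered? : ∀ m → Dec (Answered m)
answered? m = T? (is-just m)

firstAnswer : (Baire → ℕ → ℕ → Maybe ℕ) → Functional
firstAnswer g X y s with search (λ t → answered? (g X y t)) s
... | just _  = nothing
... | nothing = g X y s

module _ (g : Baire → ℕ → ℕ → Maybe ℕ) (X Y : Baire) where

  private
    unanswered : ∀ {m} → ¬ Answered m → m ≡ nothing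
    unanswered {just _}  ¬a = contradiction _ ¬a
    unanswered {nothing} _  = refl

    silent-before : ∀ y {s} → (∀ t → t < s → ¬ Answered (g X y t)) →
                    ∀ t → t < s → firstAnswer g X y t ≡ nothing
    silent-before y quiet t t<s with search (λ t → answered? (g X y t)) t
    ... | just _  = refl
    ... | nothing = unanswered (quiet t t<s)

    first-answer : ∀ y {s} → (∀ t → t < s → ¬ Answered (g X y t)) →
                   firstAnswer g X y s ≡ g X y s
    first-answer y {s} quiet rewrite search-none (λ t → answered? (g X y t)) s quiet = refl

  firstAnswer-computes : (∀ y → ∃ λ s → g X y s ≡ just (Y y)) →
                         (∀ y s v → g X y s ≡ just v → v ≡ Y y) →
                         Computes (firstAnswer g) X Y
  firstAnswer-computes answers consistent y
    with s₀ , g≡ ← answers y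
    with s , answered-s , quiet ← least (λ t → answered? (g X y t)) (subst Answered (sym g≡) _)
    with g X y s in e
  ... | just v = s , trans (first-answer y quiet) (trans e (cong just (consistent y s v e))) ,
                 silent-before y quiet

map-just⁻¹ : ∀ {A B : Set} {f : A → B} m {v} → Data.Maybe.map f m ≡ just v →
             ∃ λ a → m ≡ just a × f a ≡ v
map-just⁻¹ (just a) refl = a , refl , refl

module Chain {F : ℕ → Set} (F? : U.Decidable F) {N : ℕ → ℕ → Set} (N? : ∀ g → U.Decidable (N g)) where

  chainWithin : ℕ → ℕ → Maybe ℕ
  chainWithin s zero    = search F? s
  chainWithin s (suc j) = chainWithin s j >>= λ g → search (N? g) s

  module _ (G : ℕ → ℕ) (G-zero : Least F (G 0)) (G-suc : ∀ j → Least (N (G j)) (G (suc j)))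
           (G-increasing : ∀ j → G j < G (suc j)) where

    chainWithin-sound : ∀ s j {g} → chainWithin s j ≡ just g → g ≡ G j
    chainWithin-sound s zero e = Least-unique (proj₁ (search-just F? s e)) G-zero
    chainWithin-sound s (suc j) e with chainWithin s j in e′
    ... | just g′ with refl ← chainWithin-sound s j e′ =
      Least-unique (proj₁ (search-just (N? (G j)) s e)) (G-suc j)

    chainWithin-complete : ∀ s j → G j < s → chainWithin s j ≡ just (G j)
    chainWithin-complete s zero    G<s = search-finds F? s G-zero G<s
    chainWithin-complete s (suc j) G<s
      rewrite chainWithin-complete s j (<-trans (G-increasing j) G<s) = search-finds (N? (G j)) s (G-suc j) G<s

    chainWithin-prefix : ∀ s y {g} → chainWithin s y ≡ just g →
                         ∀ j → j ≤ y → chainWithin s j ≡ just (G j)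
    chainWithin-prefix s y e j j≤y with m≤n⇒m<n∨m≡n j≤y
    ... | inj₂ refl = trans e (cong just (chainWithin-sound s y e))
    chainWithin-prefix s (suc y) e j _ | inj₁ j<1+y with chainWithin s y in e′
    ... | just _ = chainWithin-prefix s y e′ j (≤-pred j<1+y)

module _ {P : ℕ → Set} (P? : U.Decidable P) where

  count : ℕ → ℕ
  count zero = 0
  count (suc k) with P? k
  ... | yes _ = suc (count k)
  ... | no _  = count k

module _ {P Q : ℕ → Set} (P? : U.Decidable P) (Q? : U.Decidable Q) where

  count-mono : ∀ k → (∀ z → z < k → P z → Q z) → count P? k ≤ count Q? k
  count-mono zero    _   = z≤n
  count-mono (suc k) P⊆Q with P? k | Q? k
  ... | yes Pk | no ¬Qk = contradiction (P⊆Q k ≤-refl Pk) ¬Qk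
  ... | yes _  | yes _  = s≤s (count-mono k (λ z → P⊆Q z ∘ m<n⇒m<1+n))
  ... | no _   | yes _  = m≤n⇒m≤1+n (count-mono k (λ z → P⊆Q z ∘ m<n⇒m<1+n))
  ... | no _   | no _   = count-mono k (λ z → P⊆Q z ∘ m<n⇒m<1+n)

  count-strict : ∀ k → (∀ z → z < k → P z → Q z) →
                 ∀ w → w < k → Q w → ¬ P w → count P? k < count Q? k
  count-strict (suc k) P⊆Q w w<1+k Qw ¬Pw with P? k | Q? k | m≤n⇒m<n∨m≡n (≤-pred w<1+k)
  ... | yes Pk | no ¬Qk | _         = contradiction (P⊆Q k ≤-refl Pk) ¬Qk
  ... | yes Pk | _      | inj₂ refl = contradiction Pk ¬Pw
  ... | no _   | no ¬Qk | inj₂ refl = contradiction Qw ¬Qk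
  ... | no _   | yes _  | inj₂ refl = s≤s (count-mono k (λ z → P⊆Q z ∘ m<n⇒m<1+n))
  ... | yes _  | yes _  | inj₁ w<k = s≤s (count-strict k (λ z → P⊆Q z ∘ m<n⇒m<1+n) w w<k Qw ¬Pw)
  ... | no _   | yes _  | inj₁ w<k = m<n⇒m<1+n (count-strict k (λ z → P⊆Q z ∘ m<n⇒m<1+n) w w<k Qw ¬Pw)
  ... | no _   | no _   | inj₁ w<k = count-strict k (λ z → P⊆Q z ∘ m<n⇒m<1+n) w w<k Qw ¬Pw

count-< : ∀ {P : ℕ → Set} (P? : U.Decidable P) k w → w < k → ¬ P w → count P? k < k
count-< P? k w w<k ¬Pw =
  subst (count P? k <_) (count-all k) (count-strict P? (λ _ → yes _) k (λ _ _ _ → _) w w<k _ ¬Pw)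
  where
  count-all : ∀ k → count {λ _ → ⊤} (λ _ → yes _) k ≡ k
  count-all zero    = refl
  count-all (suc k) = cong suc (count-all k)

module _ (f : ℕ → ℕ) {i₀ : ℕ} where

  mono-from : (∀ i → i₀ ≤ i → f i ≤ f (suc i)) → ∀ {i j} → i₀ ≤ i → i ≤ j → f i ≤ f j
  mono-from step {i} {j} i₀≤i i≤j with m≤n⇒m<n∨m≡n i≤j
  ... | inj₂ refl = ≤-refl
  mono-from step {i} {suc j} i₀≤i i≤j | inj₁ i<1+j =
    ≤-trans (mono-from step i₀≤i (≤-pred i<1+j)) (step j (≤-trans i₀≤i (≤-pred i<1+j)))

  strictMono-from : (∀ i → i₀ ≤ i → f i < f (suc i)) → ∀ {i j} → i₀ ≤ i → i < j → f i < f j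
  strictMono-from step {i} {j} i₀≤i i<j =
    <-≤-trans (step i i₀≤i) (mono-from (λ i i₀≤i → <⇒≤ (step i i₀≤i)) (m≤n⇒m≤1+n i₀≤i) i<j)

-- If each step either raises r, which is bounded by n, or keeps r and d
-- while raising s, then s eventually overtakes d: the measure
-- (n ∸ r i , d i ∸ s i) decreases lexicographically as long as it does not.

module _ (n : ℕ) (r s d : ℕ → ℕ) {i₁ : ℕ} (r<n : ∀ i → r i < n)
         (climb : ∀ i → i₁ ≤ i → r i < r (suc i) ⊎
                                  (r i ≡ r (suc i) × s i < s (suc i) × d (suc i) ≡ d i))
         where

  private
    _⊏_ : Rel (ℕ × ℕ) 0ℓ
    _⊏_ = ×-Lex _≡_ _<_ _<_

    μ : ℕ → ℕ × ℕ
    μ i = n ∸ r i , d i ∸ s i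

    go : ∀ i → i₁ ≤ i → Acc _⊏_ (μ i) → ∃ λ i → i₁ ≤ i × d i < s i
    go i i₁≤i (acc rec) with d i <? s i | climb i i₁≤i
    ... | yes d<s | _      = i , i₁≤i , d<s
    ... | no _    | inj₁ r< =
      go (suc i) (m≤n⇒m≤1+n i₁≤i) (rec (inj₁ (∸-monoʳ-< r< (<⇒≤ (r<n (suc i))))))
    ... | no _    | inj₂ (r≡ , s< , d≡) with d (suc i) <? s (suc i)
    ...   | yes d<s = suc i , m≤n⇒m≤1+n i₁≤i , d<s
    ...   | no d≮s  = go (suc i) (m≤n⇒m≤1+n i₁≤i) (rec (inj₂ (cong (n ∸_) (sym r≡) , gap-shrinks)))
      where
      gap-shrinks : d (suc i) ∸ s (suc i) < d i ∸ s i
      gap-shrinks rewrite d≡ = ∸-monoʳ-< s< (≮⇒≥ d≮s)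

  eventually-exceeds : ∃ λ i → i₁ ≤ i × d i < s i
  eventually-exceeds = go i₁ ≤-refl (×-wellFounded <-wellFounded <-wellFounded (μ i₁))

injective-reaches : ∀ M (h : ℕ → ℕ) → (∀ i j → i < j → j ≤ M → h i ≢ h j) →
                    ∃ λ i → i ≤ M × M ≤ h i
injective-reaches M h injective with anyUpTo? (λ i → M ≤? h i) (suc M)
... | yes (i , i<1+M , M≤hi) = i , ≤-pred i<1+M , M≤hi
... | no none = contradiction (Fin.pigeonhole ≤-refl squeeze) collision-free
  where
  small : ∀ i → i ≤ M → h i < M
  small i i≤M = ≰⇒> (λ M≤hi → none (i , s≤s i≤M , M≤hi))
  squeeze : Fin (suc M) → Fin M
  squeeze i = fromℕ< (small (toℕ i) (≤-pred (Fin.toℕ<n i)))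
  collision-free : ¬ ∃₂ λ i j → toℕ i < toℕ j × squeeze i ≡ squeeze j
  collision-free (i , j , i<j , same) =
    injective (toℕ i) (toℕ j) i<j (≤-pred (Fin.toℕ<n j))
      (trans (sym (Fin.toℕ-fromℕ< _)) (trans (cong toℕ same) (Fin.toℕ-fromℕ< _)))

module NonStrict {_≈_ _<_ : Rel ℕ 0ℓ} (sto : IsStrictTotalOrder _≈_ _<_) (≈⇒≡ : _≈_ ⇒ _≡_) where
  private module S = IsStrictTotalOrder sto

  _≤ₙ_ : Rel ℕ 0ℓ
  x ≤ₙ y = ¬ y < x

  ≤ₙ-isLinearOrder : ∀ D → IsLinearOrder D _≤ₙ_
  ≤ₙ-isLinearOrder D = refl′ , antisym′ , trans′ , total′
    where
    refl′ : ∀ x → D x → x ≤ₙ x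
    refl′ x _ = S.irrefl S.Eq.refl
    antisym′ : ∀ x y → D x → D y → x ≤ₙ y → y ≤ₙ x → x ≡ y
    antisym′ x y _ _ y≮x x≮y with S.compare x y
    ... | tri< x<y _ _ = contradiction x<y x≮y
    ... | tri≈ _ x≈y _ = ≈⇒≡ x≈y
    ... | tri> _ _ y<x = contradiction y<x y≮x
    trans′ : ∀ x y z → D x → D y → D z → x ≤ₙ y → y ≤ₙ z → x ≤ₙ z
    trans′ x y z _ _ _ y≮x z≮y z<x with S.compare y z
    ... | tri< y<z _ _ = y≮x (S.trans y<z z<x)
    ... | tri≈ _ y≈z _ = y≮x (S.<-respˡ-≈ (S.Eq.sym y≈z) z<x)
    ... | tri> _ _ z<y = z≮y z<y
    total′ : ∀ x y → D x → D y → x ≤ₙ y ⊎ y ≤ₙ x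
    total′ x y _ _ with S.compare x y
    ... | tri< _ _ y≮x = inj₁ y≮x
    ... | tri≈ _ _ y≮x = inj₁ y≮x
    ... | tri> x≮y _ _ = inj₂ x≮y

  <⇒≤ₙ×≢ : ∀ {x y} → x < y → x ≤ₙ y × x ≢ y
  <⇒≤ₙ×≢ x<y = S.asym x<y , λ { refl → S.irrefl S.Eq.refl x<y }

  ≤ₙ×≢⇒< : ∀ {x y} → x ≤ₙ y → x ≢ y → x < y
  ≤ₙ×≢⇒< {x} {y} y≮x x≢y with S.compare x y
  ... | tri< x<y _ _ = x<y
  ... | tri≈ _ x≈y _ = contradiction (≈⇒≡ x≈y) x≢y
  ... | tri> _ _ y<x = contradiction y<x y≮x

module CountAbove {_≈_ _≺_ : Rel ℕ 0ℓ} (sto : IsStrictTotalOrder _≈_ _≺_) (n : ℕ) where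
  private module S = IsStrictTotalOrder sto

  abstract
    above : ℕ → ℕ
    above u = count (u S.<?_) n

    above-antitone : ∀ {u w} → w < n → u ≺ w → above w < above u
    above-antitone {u} {w} w<n u≺w =
      count-strict (w S.<?_) (u S.<?_) n (λ _ _ → S.trans u≺w) w w<n u≺w (S.irrefl S.Eq.refl)

    above-injective : ∀ {u w} → u < n → w < n → above u ≡ above w → u ≈ w
    above-injective {u} {w} u<n w<n same with S.compare u w
    ... | tri< u≺w _ _ = contradiction (sym same) (<⇒≢ (above-antitone w<n u≺w))
    ... | tri≈ _ u≈w _ = u≈w
    ... | tri> _ _ w≺u = contradiction same (<⇒≢ (above-antitone u<n w≺u))

    above<n : ∀ {u} → u < n → above u < n
    above<n {u} u<n = count-< (u S.<?_) n u u<n (S.irrefl S.Eq.refl)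

-- The depth of a colour is its distance from the top of a linear extension
-- of the poset: sort by number of strict predecessors, break ties by index.

module Depth (n : ℕ) {_⊑_ : Rel ℕ 0ℓ} (_⊑?_ : Decidable _⊑_) where

  _⊏_ : Rel ℕ 0ℓ
  u ⊏ w = u ⊑ w × u ≢ w

  rank : ℕ → ℕ
  rank u = count (λ z → z ⊑? u ×-dec ¬? (z ≟ u)) n

  priority : ℕ → ℕ × ℕ
  priority u = rank u , u

  _≺_ : Rel ℕ 0ℓ
  _≺_ = ×-Lex _≡_ _<_ _<_ on priority

  private
    ≺-isStrictTotalOrder : IsStrictTotalOrder (Pointwise _≡_ _≡_ on priority) _≺_
    ≺-isStrictTotalOrder =
      On.isStrictTotalOrder priority (×-isStrictTotalOrder <-isStrictTotalOrder <-isStrictTotalOrder)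

  open CountAbove ≺-isStrictTotalOrder n public renaming (above to depth; above<n to depth<n)

  depth-injective : ∀ {u w} → u < n → w < n → depth u ≡ depth w → u ≡ w
  depth-injective u<n w<n same = proj₂ (above-injective u<n w<n same)

  module _ (poset : IsFinPoset n _⊑_) where

    rank-mono : ∀ {u w} → u < n → w < n → u ⊏ w → rank u < rank w
    rank-mono {u} {w} u<n w<n (u⊑w , u≢w) =
      count-strict _ _ n below-u⊆below-w u u<n (u⊑w , u≢w) (λ (_ , u≢u) → u≢u refl)
      where
      below-u⊆below-w : ∀ z → z < n → z ⊏ u → z ⊏ w
      below-u⊆below-w z z<n (z⊑u , z≢u) =
        proj₂ (proj₂ poset) z u w z<n u<n w<n z⊑u u⊑w ,
        λ { refl → z≢u (proj₁ (proj₂ poset) z u z<n u<n z⊑u u⊑w) }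

    depth-antitone : ∀ {u w} → u < n → w < n → u ⊏ w → depth w < depth u
    depth-antitone u<n w<n u⊏w = above-antitone w<n (inj₁ (rank-mono u<n w<n u⊏w))

Quad : Set
Quad = ℕ × ℕ × ℕ × ℕ

code : Quad → ℕ
code (j , v , s , x) = pair j (pair v (pair s x))

decode : ℕ → Quad
decode e with unpair e
... | j , e′ with unpair e′
... | v , e″ with unpair e″
... | s , x = j , v , s , x

decode-code : ∀ q → decode (code q) ≡ q
decode-code (j , v , s , x)
  rewrite unpair-pair j (pair v (pair s x)) | unpair-pair v (pair s x) | unpair-pair s x = refl

code-decode : ∀ e → code (decode e) ≡ e
code-decode e with unpair e in eq₁
... | j , e′ with unpair e′ in eq₂
... | v , e″ with unpair e″ in eq₃
... | s , x = begin
  pair j (pair v (pair s x))  ≡⟨ cong (pair j ∘ pair v) (repair eq₃) ⟩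
  pair j (pair v e″)          ≡⟨ cong (pair j) (repair eq₂) ⟩
  pair j e′                   ≡⟨ repair eq₁ ⟩
  e                           ∎
  where
  open ≡-Reasoning
  repair : ∀ {m x y} → unpair m ≡ (x , y) → pair x y ≡ m
  repair {m} eq = trans (cong (uncurry pair) (sym eq)) (pair-unpair m)

decode-injective : ∀ {e e′} → decode e ≡ decode e′ → e ≡ e′
decode-injective {e} {e′} same = trans (sym (code-decode e)) (trans (cong code same) (code-decode e′))

-- j and s are reversed, so that along a descending sequence of codes the
-- first entry can only grow, and while it stays put, so can the third.

_≺_ : Rel Quad 0ℓ
_≺_ = ×-Lex _≡_ _>_ (×-Lex _≡_ _<_ (×-Lex _≡_ _>_ _<_))

≺-isStrictTotalOrder : IsStrictTotalOrder (Pointwise _≡_ (Pointwise _≡_ (Pointwise _≡_ _≡_))) _≺_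
≺-isStrictTotalOrder = ×-isStrictTotalOrder >-sto (×-isStrictTotalOrder <-isStrictTotalOrder
                         (×-isStrictTotalOrder >-sto <-isStrictTotalOrder))
  where
  >-sto : IsStrictTotalOrder _≡_ _>_
  >-sto = Flip.isStrictTotalOrder <-isStrictTotalOrder

_⊏_ : Rel ℕ 0ℓ
_⊏_ = _≺_ on decode

⊏-isStrictTotalOrder : IsStrictTotalOrder _ _⊏_
⊏-isStrictTotalOrder = On.isStrictTotalOrder decode ≺-isStrictTotalOrder

≡⁴⇒≡ : Pointwise _≡_ (Pointwise _≡_ (Pointwise _≡_ _≡_)) ⇒ _≡_ {A = Quad}
≡⁴⇒≡ (refl , refl , refl , refl) = refl

open NonStrict ⊏-isStrictTotalOrder (λ same → decode-injective (≡⁴⇒≡ same))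

table : (ℕ → ℕ → ℕ) → Baire
table f = uncurry f ∘ unpair

table-pair : ∀ f x y → table f (pair x y) ≡ f x y
table-pair f x y = cong (uncurry f) (unpair-pair x y)

indicator : ∀ {P : Set} → Dec P → ℕ
indicator (yes _) = 1
indicator (no _)  = 0

module _ {P : Set} where

  indicator≡0⇒¬ : (p? : Dec P) → indicator p? ≡ 0 → ¬ P
  indicator≡0⇒¬ (no ¬p) _ = ¬p

  ¬⇒indicator≡0 : (p? : Dec P) → ¬ P → indicator p? ≡ 0
  ¬⇒indicator≡0 (yes p) ¬p = contradiction p ¬p
  ¬⇒indicator≡0 (no _)  _  = refl

  indicator>0⇒ : (p? : Dec P) → 0 < indicator p? → P
  indicator>0⇒ (yes p) _ = p

  ⇒indicator>0 : (p? : Dec P) → P → 0 < indicator p?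
  ⇒indicator>0 (yes _) _ = s≤s z≤n
  ⇒indicator>0 (no ¬p) p = contradiction p ¬p

indicator-cong : ∀ {P Q : Set} → (P → Q) → (Q → P) → (p? : Dec P) (q? : Dec Q) →
                 indicator p? ≡ indicator q?
indicator-cong P→Q Q→P (yes _) (yes _) = refl
indicator-cong P→Q Q→P (yes p) (no ¬q) = contradiction (P→Q p) ¬q
indicator-cong P→Q Q→P (no ¬p) (yes q) = contradiction (Q→P q) ¬p
indicator-cong P→Q Q→P (no _)  (no _)  = refl

record Extensional (P : Problem) : Set where
  field
    inst-≗ : ∀ {A B} → A ≗ B → Inst P A → Inst P B
    sol-≗  : ∀ {A B W} → A ≗ B → Sol P A W → Sol P B W
open Extensional

×ₚ-extensional : ∀ {P Q} → Extensional P → Extensional Q → Extensional (P ×ₚ Q)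
×ₚ-extensional P-ext Q-ext = record
  { inst-≗ = λ A≗B (iP , iQ) → inst-≗ P-ext (A≗B ∘ (2 *_)) iP , inst-≗ Q-ext (A≗B ∘ suc ∘ (2 *_)) iQ
  ; sol-≗  = λ A≗B (sP , sQ) → sol-≗ P-ext (A≗B ∘ (2 *_)) sP , sol-≗ Q-ext (A≗B ∘ suc ∘ (2 *_)) sQ
  }

^ₚ-extensional : ∀ {P} → Extensional P → ∀ m → Extensional (P ^ₚ suc m)
^ₚ-extensional P-ext zero    = P-ext
^ₚ-extensional P-ext (suc m) = ×ₚ-extensional P-ext (^ₚ-extensional P-ext m)

diagonal : Baire → ℕ → Baire
diagonal A zero    = A
diagonal A (suc m) = interleave A (diagonal A m)

firstSolution : ℕ → Baire → Baire
firstSolution zero    V = V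
firstSolution (suc m) V = π₀ V

module _ {P : Problem} (P-ext : Extensional P) {A : Baire} where

  diagonal-inst : Inst P A → ∀ m → Inst (P ^ₚ suc m) (diagonal A m)
  diagonal-inst iA zero    = iA
  diagonal-inst iA (suc m) =
    inst-≗ P-ext (sym ∘ π₀-interleave A _) iA ,
    inst-≗ (^ₚ-extensional P-ext m) (sym ∘ π₁-interleave A _) (diagonal-inst iA m)

  diagonal-sol : ∀ m {V} → Sol (P ^ₚ suc m) (diagonal A m) V → Sol P A (firstSolution m V)
  diagonal-sol zero    sA       = sA
  diagonal-sol (suc m) (sA , _) = sol-≗ P-ext (π₀-interleave A _) sA

ectCode : ℕ → (ℕ → ℕ) → Baire
ectCode k f = interleave (λ _ → k) f

ECT-extensional : Extensional ECT
ECT-extensional = record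
  { inst-≗ = λ A≗B f<k x → subst₂ _<_ (A≗B (suc (2 * x))) (A≗B 0) (f<k x)
  ; sol-≗  = λ A≗B sol x b<x → let (y , x<y , same) = sol x b<x in
               y , x<y , trans (sym (A≗B (suc (2 * x)))) (trans same (A≗B (suc (2 * y))))
  }

ectCode-inst : ∀ {k f} → (∀ x → f x < k) → Inst ECT (ectCode k f)
ectCode-inst {k} {f} f<k x = subst₂ _<_ (sym (π₁-interleave _ f x)) (sym (π₀-interleave (λ _ → k) f 0)) (f<k x)

ectCode-sol : ∀ {k f W} → Sol ECT (ectCode k f) W → ∀ x → W 0 < x → ∃ λ y → x < y × f x ≡ f y
ectCode-sol {k} {f} sol x b<x =
  let (y , x<y , same) = sol x b<x in
  y , x<y , trans (sym (π₁-interleave (λ _ → k) f x)) (trans same (π₁-interleave (λ _ → k) f y))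

wopCode : (ℕ → ℕ → ℕ) → (ℕ → ℕ → ℕ) → Baire
wopCode le σ = interleave (λ _ → 1) (interleave (table le) (table σ))

module _ (le σ : ℕ → ℕ → ℕ) {C : Baire} (C≗ : C ≗ wopCode le σ) where

  private
    tables : Baire
    tables = interleave (table le) (table σ)

  wDom-wopCode : ∀ x → wDom C x
  wDom-wopCode x = subst (0 <_) (sym (trans (C≗ _) (π₀-interleave (λ _ → 1) _ x))) (s≤s z≤n)

  wLe-wopCode : ∀ x y → π₀ (π₁ C) (pair x y) ≡ le x y
  wLe-wopCode x y = begin
    π₀ (π₁ C) (pair x y)                            ≡⟨ C≗ _ ⟩
    π₀ (π₁ (wopCode le σ)) (pair x y)               ≡⟨ π₁-interleave (λ _ → 1) tables (2 * pair x y) ⟩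
    interleave (table le) (table σ) (2 * pair x y)  ≡⟨ π₀-interleave (table le) (table σ) (pair x y) ⟩
    table le (pair x y)                             ≡⟨ table-pair le x y ⟩
    le x y                                          ∎
    where open ≡-Reasoning

  wσ-wopCode : ∀ i j → wσ C i j ≡ σ i j
  wσ-wopCode i j = begin
    π₁ (π₁ C) (pair i j)                                  ≡⟨ C≗ _ ⟩
    π₁ (π₁ (wopCode le σ)) (pair i j)                     ≡⟨ π₁-interleave (λ _ → 1) tables (suc (2 * pair i j)) ⟩
    interleave (table le) (table σ) (suc (2 * pair i j))  ≡⟨ π₁-interleave (table le) (table σ) (pair i j) ⟩
    table σ (pair i j)                                    ≡⟨ table-pair σ i j ⟩
    σ i j                                                 ∎
    where open ≡-Reasoning

IsLinearOrder-⇔ : ∀ {D le le′} → (∀ x y → le x y ⇔ le′ x y) → IsLinearOrder D le → IsLinearOrder D le′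
IsLinearOrder-⇔ {le = le} {le′} le⇔le′ (refl′ , antisym′ , trans′ , total′) =
  (λ x Dx → to (refl′ x Dx)) ,
  (λ x y Dx Dy p q → antisym′ x y Dx Dy (from p) (from q)) ,
  (λ x y z Dx Dy Dz p q → to (trans′ x y z Dx Dy Dz (from p) (from q))) ,
  (λ x y Dx Dy → Data.Sum.map to to (total′ x y Dx Dy))
  where
  to : ∀ {x y} → le x y → le′ x y
  to = Equivalence.to (le⇔le′ _ _)
  from : ∀ {x y} → le′ x y → le x y
  from = Equivalence.from (le⇔le′ _ _)

module Construction (col : ℕ → ℕ → ℕ) (depth : ℕ → ℕ) where

  Changes : ℕ → ℕ → Set
  Changes x s = col x s ≢ col x (suc s)

  changes? : ∀ x s → Dec (Changes x s)
  changes? x s = ¬? (col x s ≟ col x (suc s))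

  newDepth : ℕ → ℕ → ℕ
  newDepth s x = depth (col x (suc s))

  -- The event of stage s is the least depth of a new colour col x (suc s)
  -- for x = s or x < s changing colour at s; such an x is its trigger.
  best : ℕ → ℕ → ℕ
  best s zero    = s
  best s (suc k) with changes? k s | newDepth s k <? newDepth s (best s k)
  ... | yes _ | yes _ = k
  ... | _     | _     = best s k

  best-candidate : ∀ s k → best s k ≡ s ⊎ (best s k < k × Changes (best s k) s)
  best-candidate s zero = inj₁ refl
  best-candidate s (suc k) with changes? k s | newDepth s k <? newDepth s (best s k)
  ... | yes ch | yes _ = inj₂ (≤-refl , ch)
  ... | yes _  | no _  = Data.Sum.map₂ (Data.Product.map₁ m<n⇒m<1+n) (best-candidate s k)
  ... | no _   | _     = Data.Sum.map₂ (Data.Product.map₁ m<n⇒m<1+n) (best-candidate s k)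

  best-minimal : ∀ s k x → x < k → Changes x s → newDepth s (best s k) ≤ newDepth s x
  best-minimal s (suc k) x x<1+k ch
    with changes? k s | newDepth s k <? newDepth s (best s k) | m≤n⇒m<n∨m≡n (≤-pred x<1+k)
  ... | yes _  | yes _  | inj₂ refl = ≤-refl
  ... | yes _  | yes k< | inj₁ x<k  = ≤-trans (<⇒≤ k<) (best-minimal s k x x<k ch)
  ... | yes _  | no k≮  | inj₂ refl = ≮⇒≥ k≮
  ... | yes _  | no _   | inj₁ x<k  = best-minimal s k x x<k ch
  ... | no ¬ch | _      | inj₂ refl = contradiction ch ¬ch
  ... | no _   | _      | inj₁ x<k  = best-minimal s k x x<k ch

  trigger : ℕ → ℕ
  trigger s = best s s

  event : ℕ → ℕ
  event s = newDepth s (trigger s)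

  trigger-≤ : ∀ s → trigger s ≤ s
  trigger-≤ s with best-candidate s s
  ... | inj₁ t≡s      = ≤-reflexive t≡s
  ... | inj₂ (t<s , _) = <⇒≤ t<s

  trigger-changes : ∀ s → trigger s ≡ s ⊎ Changes (trigger s) s
  trigger-changes s = Data.Sum.map₂ proj₂ (best-candidate s s)

  event-minimal : ∀ s x → x < s → Changes x s → event s ≤ newDepth s x
  event-minimal s = best-minimal s s

  -- One plus the last stage before T whose event is below j (0 if none).
  lastBelow : ℕ → ℕ → ℕ
  lastBelow j zero    = 0
  lastBelow j (suc T) with event T <? j
  ... | yes _ = suc T
  ... | no _  = lastBelow j T

  lastBelow-hit : ∀ j T → event T < j → lastBelow j (suc T) ≡ suc T
  lastBelow-hit j T e<j with event T <? j
  ... | yes _ = refl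
  ... | no e≮j = contradiction e<j e≮j

  lastBelow-skip : ∀ j T → j ≤ event T → lastBelow j (suc T) ≡ lastBelow j T
  lastBelow-skip j T j≤e with event T <? j
  ... | yes e<j = contradiction j≤e (<⇒≱ e<j)
  ... | no _    = refl

  lastBelow-≤ : ∀ j T → lastBelow j T ≤ T
  lastBelow-≤ j zero = z≤n
  lastBelow-≤ j (suc T) with event T <? j
  ... | yes _ = ≤-refl
  ... | no _  = m≤n⇒m≤1+n (lastBelow-≤ j T)

  lastBelow-mono : ∀ j {T T′} → T ≤ T′ → lastBelow j T ≤ lastBelow j T′
  lastBelow-mono j = mono-from (lastBelow j) step z≤n
    where
    step : ∀ T → 0 ≤ T → lastBelow j T ≤ lastBelow j (suc T)
    step T _ with event T <? j
    ... | yes _ = m≤n⇒m≤1+n (lastBelow-≤ j T)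
    ... | no _  = ≤-refl

  lastBelow-event : ∀ j T {s} → lastBelow j T ≡ suc s → event s < j
  lastBelow-event j (suc T) e with event T <? j
  lastBelow-event j (suc T) refl | yes e<j = e<j
  ... | no _ = lastBelow-event j T e

  lastBelow-after : ∀ j {s T} → event s < j → s < T → s < lastBelow j T
  lastBelow-after j {s} e<j s<T =
    ≤-trans (≤-reflexive (sym (lastBelow-hit j s e<j))) (lastBelow-mono j s<T)

  -- Register j at time T: its version, the stage it was last restarted,
  -- and the trigger of that restart.
  register : ℕ → ℕ → Quad
  register T j = j , lastBelow j T , lastBelow (suc j) T , trigger (pred (lastBelow (suc j) T))

  σ : ℕ → ℕ → ℕ
  σ T j = code (register T j)

  σ-below : ∀ T j → j < event T → σ (suc T) j ≡ σ T j
  σ-below T j j<e rewrite lastBelow-skip j T (<⇒≤ j<e) | lastBelow-skip (suc j) T j<e = refl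

  register-restart : ∀ T → register (suc T) (event T) ≺ register T (event T)
  register-restart T rewrite lastBelow-skip (event T) T ≤-refl | lastBelow-hit (suc (event T)) T ≤-refl =
    inj₂ (refl , inj₂ (refl , inj₁ (s≤s (lastBelow-≤ (suc (event T)) T))))

  σ-restart : ∀ T → σ (suc T) (event T) ⊏ σ T (event T)
  σ-restart T = subst₂ _≺_ (sym (decode-code _)) (sym (decode-code _)) (register-restart T)

  register-descent : ∀ {T T′ j j′} → T ≤ T′ → register T′ j′ ≺ register T j →
                     j < j′ ⊎ (j ≡ j′ × lastBelow (suc j) T < lastBelow (suc j′) T′ ×
                                        lastBelow j′ T′ ≡ lastBelow j T)
  register-descent T≤T′ (inj₁ j<j′) = inj₁ j<j′
  register-descent {j = j} T≤T′ (inj₂ (refl , inj₁ v′<v)) =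
    contradiction (lastBelow-mono j T≤T′) (<⇒≱ v′<v)
  register-descent T≤T′ (inj₂ (refl , inj₂ (v≡ , inj₁ s<s′))) = inj₂ (refl , s<s′ , v≡)
  register-descent T≤T′ (inj₂ (refl , inj₂ (_ , inj₂ (s≡ , x′<x)))) =
    contradiction (cong (trigger ∘ pred) s≡) (<⇒≢ x′<x)


module Forward (k : ℕ) (X : Baire) where

  n : ℕ
  n = suc k

  _⊑?_ : Decidable (ortLeq X)
  u ⊑? w = π₀ (π₁ X) (pair u w) ≟ 0

  open Depth n _⊑?_ public using (depth; depth<n; depth-injective; depth-antitone)
  open Construction (ortCol X) depth public

  leTable : ℕ → ℕ → ℕ
  leTable x y = indicator (IsStrictTotalOrder._<?_ ⊏-isStrictTotalOrder y x)

  image : Baire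
  image = interleave (diagonal (ectCode n event) k) (wopCode leTable σ)

  ect≗ : π₀ image ≗ diagonal (ectCode n event) k
  ect≗ = π₀-interleave (diagonal (ectCode n event) k) (wopCode leTable σ)

  wop≗ : π₁ image ≗ wopCode leTable σ
  wop≗ = π₁-interleave (diagonal (ectCode n event) k) (wopCode leTable σ)

  wσ-image : ∀ T j → wσ (π₁ image) T j ≡ σ T j
  wσ-image = wσ-wopCode leTable σ wop≗

  ≤ₙ⇔wLe : ∀ x y → x ≤ₙ y ⇔ wLe (π₁ image) x y
  ≤ₙ⇔wLe x y = mk⇔
    (λ ≤ₙ → trans (wLe-wopCode leTable σ wop≗ x y) (¬⇒indicator≡0 _ ≤ₙ))
    (λ le → indicator≡0⇒¬ _ (trans (sym (wLe-wopCode leTable σ wop≗ x y)) le))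

  module Correct (ins : ORTInst X) (size : ortSize X ≡ n) where

    col<n : ∀ {x y} → x < y → ortCol X x y < n
    col<n {x} {y} x<y = subst (ortCol X x y <_) size (proj₁ (proj₂ ins) x y x<y)

    isFinPoset : IsFinPoset n (ortLeq X)
    isFinPoset = subst (λ m → IsFinPoset m (ortLeq X)) size (proj₁ ins)

    event<n : ∀ s → event s < n
    event<n s = depth<n (col<n (s≤s (trigger-≤ s)))

    -- Once every event after b is at least j, the colour of x ≤ s at stage
    -- s + 1, if of depth j, can no longer change: by right-orderedness a
    -- change would raise it in the poset, i.e. lower its depth, and so cause
    -- an event below j.
    colour-settles : ∀ {b j x s} → (∀ y → b < y → j ≤ event y) → b < s → x ≤ s → newDepth s x ≡ j →
                     ∀ y → suc s ≤ y → ortCol X x y ≡ ortCol X x (suc s)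
    colour-settles {b} {j} {x} {s} floor b<s x≤s depth≡ y s<y with m≤n⇒m<n∨m≡n s<y
    ... | inj₂ refl = refl
    colour-settles {b} {j} {x} {s} floor b<s x≤s depth≡ (suc y) s<y | inj₁ s<1+y
      with ortCol X x y ≟ ortCol X x (suc y)
    ... | yes same = trans (sym same) (colour-settles floor b<s x≤s depth≡ y (≤-pred s<1+y))
    ... | no change = contradiction (floor y b<y) (<⇒≱ (begin-strict
        event y                     ≤⟨ event-minimal y x x<y change ⟩
        depth (ortCol X x (suc y))  <⟨ depth-antitone isFinPoset (col<n x<y) (col<n (m<n⇒m<1+n x<y))
                                         (proj₂ (proj₂ ins) x y (suc y) x<y (n≤1+n y) , change) ⟩
        depth (ortCol X x y)        ≡⟨ cong depth (colour-settles floor b<s x≤s depth≡ y (≤-pred s<1+y)) ⟩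
        depth (ortCol X x (suc s))  ≡⟨ depth≡ ⟩
        j                           ∎))
      where
      open ≤-Reasoning
      x<y : x < y
      x<y = ≤-<-trans x≤s (≤-pred s<1+y)
      b<y : b < y
      b<y = <-≤-trans b<s (≤-trans (n≤1+n s) (≤-pred s<1+y))

    image-inst : Inst ((ECT ^ₚ n) ×ₚ WOPlex n) image
    image-inst = ect-inst , linear , (λ i j _ → wDom-wopCode leTable σ wop≗ (wσ (π₁ image) i j)) ,
                 descending
      where
      ect-inst : Inst (ECT ^ₚ n) (π₀ image)
      ect-inst = inst-≗ (^ₚ-extensional ECT-extensional k) (sym ∘ ect≗)
                   (diagonal-inst ECT-extensional (ectCode-inst event<n) k)
      linear : IsLinearOrder (wDom (π₁ image)) (wLe (π₁ image))
      linear = IsLinearOrder-⇔ ≤ₙ⇔wLe (≤ₙ-isLinearOrder _)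
      descending : ∀ T → LexLt (wLt (π₁ image)) n (wσ (π₁ image) (suc T)) (wσ (π₁ image) T)
      descending T = event T , event<n T , agree , restart
        where
        agree : ∀ j → j < event T → wσ (π₁ image) (suc T) j ≡ wσ (π₁ image) T j
        agree j j<e = trans (wσ-image (suc T) j) (trans (σ-below T j j<e) (sym (wσ-image T j)))
        restart : wLt (π₁ image) (wσ (π₁ image) (suc T) (event T)) (wσ (π₁ image) T (event T))
        restart = subst₂ (wLt (π₁ image)) (sym (wσ-image (suc T) (event T))) (sym (wσ-image T (event T)))
                    (Data.Product.map₁ (Equivalence.to (≤ₙ⇔wLe (σ (suc T) (event T)) (σ T (event T))))
                                       (<⇒≤ₙ×≢ (σ-restart T)))

module Backward (k : ℕ) (Ŷ : Baire) where

  b : ℕ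
  b = firstSolution k (π₀ Ŷ) 0

  W : Baire
  W = π₁ Ŷ

  reg version start payload : ℕ → ℕ
  reg     i = proj₁ (decode (W i))
  version i = proj₁ (proj₂ (decode (W i)))
  start   i = proj₁ (proj₂ (proj₂ (decode (W i))))
  payload i = proj₂ (proj₂ (proj₂ (decode (W i))))

  Fresh : ℕ → Set
  Fresh i = suc b < start i

  Next : ℕ → ℕ → Set
  Next g i = g < i × start g ≤ payload i

  Fresh? : U.Decidable Fresh
  Fresh? i = suc b <? start i

  Next? : ∀ g → U.Decidable (Next g)
  Next? g i = g <? i ×-dec start g ≤? payload i

  open Chain Fresh? Next? public using (chainWithin)

  payloadWithin : ℕ → ℕ → ℕ
  payloadWithin s j = maybe′ payload 0 (chainWithin s j)

  answer : ℕ → ℕ → Maybe ℕ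
  answer y s = Data.Maybe.map (λ _ → indicator (anyUpTo? (λ j → payloadWithin s j ≟ y) (suc y)))
                              (chainWithin s y)

backward : ℕ → Functional
backward k = firstAnswer (λ Ŷ → Backward.answer k Ŷ)

module Analysis (k : ℕ) (X : Baire) (ins : ORTInst X) (size : ortSize X ≡ suc k) (Ŷ : Baire)
                (sol : Sol ((ECT ^ₚ suc k) ×ₚ WOPlex (suc k)) (Forward.image k X) Ŷ) where

  open Forward k X
  open Correct ins size
  open Backward k Ŷ

  recurs : ∀ {x} → b < x → ∃ λ y → x < y × event x ≡ event y
  recurs {x} = ectCode-sol {n} {event} {firstSolution k (π₀ Ŷ)}
                 (diagonal-sol ECT-extensional {ectCode n event} k ect-sol) x
    where
    ect-sol : Sol (ECT ^ₚ n) (diagonal (ectCode n event) k) (π₀ Ŷ)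
    ect-sol = sol-≗ (^ₚ-extensional ECT-extensional k) {π₀ image} ect≗ (proj₁ sol)

  recurs-beyond : ∀ {s₀} → b < s₀ → ∀ N → ∃ λ s → N ≤ s × b < s × event s ≡ event s₀
  recurs-beyond {s₀} b<s₀ zero = s₀ , z≤n , b<s₀ , refl
  recurs-beyond b<s₀ (suc N) =
    let s , N≤s , b<s , e = recurs-beyond b<s₀ N
        y , s<y , e′      = recurs b<s
    in  y , ≤-<-trans N≤s s<y , <-trans b<s s<y , trans (sym e′) e

  private
    indexing : ∃ λ t → (∀ i i′ → i < i′ → t i ≤ t i′) ×
                       (∀ i → ∃ λ j → j < n × W i ≡ wσ (π₁ image) (t i) j)
    indexing = proj₂ (proj₂ (proj₂ sol))

  t : ℕ → ℕ
  t = proj₁ indexing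

  t-mono : ∀ {i i′} → i ≤ i′ → t i ≤ t i′
  t-mono {i} {i′} i≤i′ =
    [ proj₁ (proj₂ indexing) i i′ , (λ { refl → ≤-refl }) ]′ (m≤n⇒m<n∨m≡n i≤i′)

  private
    located : ∀ i → ∃ λ j → j < n × decode (W i) ≡ register (t i) j
    located i =
      let j , j<n , W≡ = proj₂ (proj₂ indexing) i
      in  j , j<n , trans (cong decode (trans W≡ (wσ-image (t i) j))) (decode-code (register (t i) j))

  W-register : ∀ i → decode (W i) ≡ register (t i) (reg i)
  W-register i = let W≡ = proj₂ (proj₂ (located i)) in
                 trans W≡ (cong (register (t i)) (sym (cong proj₁ W≡)))

  reg<n : ∀ i → reg i < n
  reg<n i = subst (_< n) (sym (cong proj₁ (proj₂ (proj₂ (located i))))) (proj₁ (proj₂ (located i)))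

  version≡ : ∀ i → version i ≡ lastBelow (reg i) (t i)
  version≡ i = cong (proj₁ ∘ proj₂) (W-register i)

  start≡ : ∀ i → start i ≡ lastBelow (suc (reg i)) (t i)
  start≡ i = cong (proj₁ ∘ proj₂ ∘ proj₂) (W-register i)

  payload≡ : ∀ i → payload i ≡ trigger (pred (start i))
  payload≡ i = trans (cong (proj₂ ∘ proj₂ ∘ proj₂) (W-register i)) (cong (trigger ∘ pred) (sym (start≡ i)))

  W-descends : ∀ i → W (suc i) ⊏ W i
  W-descends i =
    let le , ≢ = proj₁ (proj₂ (proj₂ sol)) i
    in  ≤ₙ×≢⇒< (Equivalence.from (≤ₙ⇔wLe (W (suc i)) (W i)) le) ≢

  step : ∀ i → reg i < reg (suc i) ⊎
               (reg i ≡ reg (suc i) × start i < start (suc i) × version (suc i) ≡ version i)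
  step i = Data.Sum.map₂ from-registers
             (register-descent {t i} {t (suc i)} {reg i} {reg (suc i)} (t-mono (n≤1+n i))
               (subst₂ _≺_ (W-register (suc i)) (W-register i) (W-descends i)))
    where
    from-registers : reg i ≡ reg (suc i) ×
                     lastBelow (suc (reg i)) (t i) < lastBelow (suc (reg (suc i))) (t (suc i)) ×
                     lastBelow (reg (suc i)) (t (suc i)) ≡ lastBelow (reg i) (t i) →
                     reg i ≡ reg (suc i) × start i < start (suc i) × version (suc i) ≡ version i
    from-registers (r≡ , s< , v≡) =
      r≡ , subst₂ _<_ (sym (start≡ i)) (sym (start≡ (suc i))) s< ,
      trans (version≡ (suc i)) (trans v≡ (sym (version≡ i)))

  reg-mono : ∀ {i i′} → i ≤ i′ → reg i ≤ reg i′
  reg-mono = mono-from reg (λ i _ → [ <⇒≤ , ≤-reflexive ∘ proj₁ ]′ (step i)) z≤n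

  -- If event s₀ recurs forever, no register stays above it from some point
  -- on: each such register is bounded by a recurrence of event s₀ after its
  -- version, so it could only climb through finitely many restarts.
  reg-not-above : ∀ {s₀} → b < s₀ → ∀ i₁ → ¬ (∀ i → i₁ ≤ i → event s₀ < reg i)
  reg-not-above {s₀} b<s₀ i₁ above =
    let i , i₁≤i , E<start = eventually-exceeds n reg start (E ∘ version) reg<n climb
    in  <⇒≱ E<start (start≤E i i₁≤i)
    where
    E : ℕ → ℕ
    E v = proj₁ (recurs-beyond b<s₀ (suc v))

    climb : ∀ i → i₁ ≤ i → reg i < reg (suc i) ⊎
                           (reg i ≡ reg (suc i) × start i < start (suc i) × E (version (suc i)) ≡ E (version i))
    climb i _ = Data.Sum.map₂ (λ (r≡ , s< , v≡) → r≡ , s< , cong E v≡) (step i)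

    start≤E : ∀ i → i₁ ≤ i → start i ≤ E (version i)
    start≤E i i₁≤i = [ t≤E⇒ , E<t⇒ ]′ (≤-<-connex (t i) (E (version i)))
      where
      t≤E⇒ : t i ≤ E (version i) → start i ≤ E (version i)
      t≤E⇒ t≤E = ≤-trans (≤-reflexive (start≡ i)) (≤-trans (lastBelow-≤ (suc (reg i)) (t i)) t≤E)
      E<t⇒ : E (version i) < t i → start i ≤ E (version i)
      E<t⇒ E<t =
        let v<E , _ , e = proj₂ (recurs-beyond b<s₀ (suc (version i)))
            E<v = lastBelow-after (reg i) (subst (_< reg i) (sym e) (above i i₁≤i)) E<t
        in  contradiction (subst (E (version i) <_) (sym (version≡ i)) E<v) (<-asym v<E)

  abstract
    i₀-Least : ∃ (Least Fresh)
    i₀-Least =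
      let i , _ , fresh = eventually-exceeds n reg start (λ _ → suc b) {0} reg<n
                            (λ i _ → Data.Sum.map₂ (λ (r≡ , s< , _) → r≡ , s< , refl) (step i))
      in  least Fresh? {i} fresh

  i₀ : ℕ
  i₀ = proj₁ i₀-Least

  j₀ : ℕ
  j₀ = reg i₀

  stage : ℕ → ℕ
  stage i = pred (start i)

  module _ (i : ℕ) (fresh : Fresh i) where

    start≡suc-stage : start i ≡ suc (stage i)
    start≡suc-stage = sym (suc-pred (start i) ⦃ >-nonZero (<-trans z<s fresh) ⦄)

    b<stage : b < stage i
    b<stage = ≤-pred (subst (suc b <_) start≡suc-stage fresh)

    event-stage≤reg : event (stage i) ≤ reg i
    event-stage≤reg = ≤-pred (lastBelow-event (suc (reg i)) (t i) (trans (sym (start≡ i)) start≡suc-stage))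

  event-floor : ∀ y → b < y → j₀ ≤ event y
  event-floor y b<y =
    ≮⇒≥ λ e<j₀ → reg-not-above b<y i₀ (λ i i₀≤i → <-≤-trans e<j₀ (reg-mono i₀≤i))

  reg-stable : ∀ {i} → i₀ ≤ i → reg i ≡ j₀
  reg-stable {i} i₀≤i = ≤-antisym (≮⇒≥ j₀<reg) (reg-mono i₀≤i)
    where
    fresh₀ : Fresh i₀
    fresh₀ = proj₁ (proj₂ i₀-Least)
    j₀<reg : ¬ j₀ < reg i
    j₀<reg j₀<r = reg-not-above (b<stage i₀ fresh₀) i λ i′ i≤i′ →
                    <-≤-trans (≤-<-trans (event-stage≤reg i₀ fresh₀) j₀<r) (reg-mono i≤i′)

  start-increasing : ∀ i → i₀ ≤ i → start i < start (suc i)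
  start-increasing i i₀≤i =
    [ (λ r< → contradiction (trans (reg-stable i₀≤i) (sym (reg-stable (m≤n⇒m≤1+n i₀≤i)))) (<⇒≢ r<)) ,
      proj₁ ∘ proj₂ ]′ (step i)

  fresh-after : ∀ {i} → i₀ ≤ i → Fresh i
  fresh-after i₀≤i = <-≤-trans (proj₁ (proj₂ i₀-Least))
                       (mono-from start (λ i i₀≤i → <⇒≤ (start-increasing i i₀≤i)) ≤-refl i₀≤i)

  colour : ℕ → ℕ
  colour i = ortCol X (payload i) (start i)

  payload≤stage : ∀ i → payload i ≤ stage i
  payload≤stage i = ≤-trans (≤-reflexive (payload≡ i)) (trigger-≤ (stage i))

  module _ {i : ℕ} (i₀≤i : i₀ ≤ i) where

    private
      fresh : Fresh i
      fresh = fresh-after i₀≤i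

    payload<start : payload i < start i
    payload<start = subst (payload i <_) (sym (start≡suc-stage i fresh)) (s≤s (payload≤stage i))

    payload-depth : newDepth (stage i) (payload i) ≡ j₀
    payload-depth = trans (cong (newDepth (stage i)) (payload≡ i))
                      (≤-antisym (subst (event (stage i) ≤_) (reg-stable i₀≤i) (event-stage≤reg i fresh))
                                 (event-floor (stage i) (b<stage i fresh)))

    payload-settled : ∀ {y} → start i ≤ y → ortCol X (payload i) y ≡ colour i
    payload-settled {y} start≤y =
      trans (colour-settles event-floor (b<stage i fresh) (payload≤stage i) payload-depth y
              (subst (_≤ y) (start≡suc-stage i fresh) start≤y))
            (cong (ortCol X (payload i)) (sym (start≡suc-stage i fresh)))

    colour-depth : depth (colour i) ≡ j₀
    colour-depth = trans (cong (depth ∘ ortCol X (payload i)) (start≡suc-stage i fresh)) payload-depth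

  colour-constant : ∀ {i} → i₀ ≤ i → colour i ≡ colour i₀
  colour-constant i₀≤i = depth-injective (col<n (payload<start i₀≤i)) (col<n (payload<start ≤-refl))
                           (trans (colour-depth i₀≤i) (sym (colour-depth ≤-refl)))

  -- A later payload is either its own stage, which is past the earlier one,
  -- or a colour change at that stage, which a settled payload cannot have.
  payload-distinct : ∀ {i i′} → i₀ ≤ i → i < i′ → payload i ≢ payload i′
  payload-distinct {i} {i′} i₀≤i i<i′ same =
    [ trigger-is-stage , trigger-changes′ ]′ (trigger-changes (stage i′))
    where
    start≤stage′ : start i ≤ stage i′
    start≤stage′ = ≤-pred (subst (start i <_) (start≡suc-stage i′ fresh′)
                                 (strictMono-from start start-increasing i₀≤i i<i′))
      where fresh′ = fresh-after (≤-trans i₀≤i (<⇒≤ i<i′))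
    trigger-is-stage : trigger (stage i′) ≡ stage i′ → ⊥
    trigger-is-stage t≡ =
      <-irrefl (trans same (trans (payload≡ i′) t≡)) (<-≤-trans (payload<start i₀≤i) start≤stage′)
    trigger-changes′ : Changes (trigger (stage i′)) (stage i′) → ⊥
    trigger-changes′ change =
      subst (λ x → Changes x (stage i′)) (sym (trans same (payload≡ i′))) change
        (trans (payload-settled i₀≤i start≤stage′)
               (sym (payload-settled i₀≤i (m≤n⇒m≤1+n start≤stage′))))

  next-exists : ∀ {g} → i₀ ≤ g → ∃ (Next g)
  next-exists {g} i₀≤g =
    let c , _ , start≤ = injective-reaches (start g) (λ c → payload (suc c + g))
                           (λ c c′ c<c′ _ → payload-distinct (≤-trans i₀≤g (m≤n+m g (suc c)))
                                                               (+-monoˡ-< g (s≤s c<c′)))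
    in  suc c + g , s≤s (m≤n+m g c) , start≤

  abstract
    successor : ∀ {g} → i₀ ≤ g → ∃ (Least (Next g))
    successor {g} i₀≤g = least (Next? g) (proj₂ (next-exists i₀≤g))

  chain : ℕ → Σ ℕ (i₀ ≤_)
  chain zero    = i₀ , ≤-refl
  chain (suc j) = let g , i₀≤g = chain j
                      i , (g<i , _) , _ = successor i₀≤g
                  in  i , ≤-trans i₀≤g (<⇒≤ g<i)

  G : ℕ → ℕ
  G j = proj₁ (chain j)

  i₀≤G : ∀ j → i₀ ≤ G j
  i₀≤G j = proj₂ (chain j)

  G-Least : ∀ j → Least (Next (G j)) (G (suc j))
  G-Least j = proj₂ (successor (i₀≤G j))

  p : ℕ → ℕ
  p j = payload (G j)

  p-increasing : ∀ j → p j < p (suc j)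
  p-increasing j = <-≤-trans (payload<start (i₀≤G j)) (proj₂ (proj₁ (G-Least j)))

  j≤p : ∀ j → j ≤ p j
  j≤p zero    = z≤n
  j≤p (suc j) = <-≤-trans (s≤s (j≤p j)) (p-increasing j)

  p-mono : ∀ {j j′} → j ≤ j′ → p j ≤ p j′
  p-mono = mono-from p (λ j _ → <⇒≤ (p-increasing j)) z≤n

  open Chain Fresh? Next? using (chainWithin-sound; chainWithin-complete; chainWithin-prefix)

  private
    G-increasing : ∀ j → G j < G (suc j)
    G-increasing j = proj₁ (proj₁ (G-Least j))

    found : ∀ s y {g} → chainWithin s y ≡ just g → ∀ j → j ≤ y → chainWithin s j ≡ just (G j)
    found = chainWithin-prefix G (proj₂ i₀-Least) G-Least G-increasing

    found-eventually : ∀ s j → G j < s → chainWithin s j ≡ just (G j)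
    found-eventually = chainWithin-complete G (proj₂ i₀-Least) G-Least G-increasing

  solution : Baire
  solution y = indicator (anyUpTo? (λ j → p j ≟ y) (suc y))

  answer-agrees : ∀ s y {g} → chainWithin s y ≡ just g →
                  indicator (anyUpTo? (λ j → payloadWithin s j ≟ y) (suc y)) ≡ solution y
  answer-agrees s y e = indicator-cong
    (λ (j , j<1+y , pw≡) → j , j<1+y , trans (sym (payloadWithin≡p j j<1+y)) pw≡)
    (λ (j , j<1+y , p≡) → j , j<1+y , trans (payloadWithin≡p j j<1+y) p≡)
    _ _
    where
    payloadWithin≡p : ∀ j → j < suc y → payloadWithin s j ≡ p j
    payloadWithin≡p j j<1+y = cong (maybe′ payload 0) (found s y e j (≤-pred j<1+y))

  answer-consistent : ∀ y s v → answer y s ≡ just v → v ≡ solution y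
  answer-consistent y s v e =
    let _ , found-y , v≡ = map-just⁻¹ (chainWithin s y) e
    in  trans (sym v≡) (answer-agrees s y found-y)

  answer-eventually : ∀ y → answer y (suc (G y)) ≡ just (solution y)
  answer-eventually y = trans (map-just found-y) (cong just (answer-agrees (suc (G y)) y found-y))
    where
    found-y : chainWithin (suc (G y)) y ≡ just (G y)
    found-y = found-eventually (suc (G y)) y ≤-refl

  solution-computed : Computes (backward k) Ŷ solution
  solution-computed = firstAnswer-computes (λ Ŷ → Backward.answer k Ŷ) Ŷ solution
               (λ y → suc (G y) , answer-eventually y) answer-consistent

  start≤p : ∀ {j j′} → j < j′ → start (G j) ≤ p j′
  start≤p {j} j<j′ = ≤-trans (proj₂ (proj₁ (G-Least j))) (p-mono j<j′)

  isSolution : ORTSol X solution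
  isSolution = infinite , colour i₀ , same-colour
    where
    infinite : InfiniteSet solution
    infinite m = p m , j≤p m ,
                 ⇒indicator>0 (anyUpTo? (λ j → p j ≟ p m) (suc (p m))) (m , s≤s (j≤p m) , refl)
    same-colour : ∀ x y → x < y → x ∈ₛ solution → y ∈ₛ solution → ortCol X x y ≡ colour i₀
    same-colour x y x<y x∈ y∈ =
      let j  , _ , p≡x = indicator>0⇒ (anyUpTo? (λ j → p j ≟ x) (suc x)) x∈
          j′ , _ , p≡y = indicator>0⇒ (anyUpTo? (λ j → p j ≟ y) (suc y)) y∈
      in  subst₂ (λ x y → ortCol X x y ≡ colour i₀) p≡x p≡y
            ([ (λ j<j′ → trans (payload-settled (i₀≤G j) (start≤p j<j′)) (colour-constant (i₀≤G j))) ,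
               (λ j′≤j → contradiction (subst₂ _≤_ p≡y p≡x (p-mono j′≤j)) (<⇒≱ x<y))
             ]′ (<-≤-connex j j′))

mainTheorem5 : ∀ (n : ℕ) → 1 ≤ n → ORT[ n ] ≤sW ((ECT ^ₚ n) ×ₚ WOPlex n)
mainTheorem5 zero    ()
mainTheorem5 (suc k) _ = forward , backward k , λ X (ins , size) →
  Forward.image k X , (λ m → 0 , refl , λ _ ()) , Forward.Correct.image-inst k X ins size ,
  λ Ŷ sol → let open Analysis k X ins size Ŷ sol in solution , solution-computed , isSolution
  where
  forward : Functional
  forward X m _ = just (Forward.image k X m)
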